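{- The DCell $D_{k,n}$ is super-$\lambda_2$ whenever either $k\geq3$ and $n\geq2$, or $k=2$ and $n=2$. That is, every minimum $2$-restricted edge-cut $F$ of $D_{k,n}$ is such that $D_{k,n}-F$ has a component consisting of exactly two adjacent vertices.
   Context: DCell $D_{k,n}$ ($n\geq 2$, $k\geq 0$) is defined recursively. $D_{0,n}$ is the complete graph $K_n$ on vertices $0,1,\dots,n-1$. Let $t_{k,n}=|V(D_{k,n})|$. For $k\geq1$, $D_{k,n}$ is built from $t_{k-1,n}+1$ disjoint copies $D^0_{k-1,n},\dots,D^{t_{k-1,n}}_{k-1,n}$ of $D_{k-1,n}$; a vertex of copy $D^i_{k-1,n}$ is labeled $(i,a_{k-1},\dots,a_0)$, where $(a_{k-1},\dots,a_0)$ is its label in $D_{k-1,n}$, and its index within the copy is $uid_{k-1}=a_0+\sum_{l=1}^{k-1}a_l t_{l-1,n}$. For each pair $a<b$ of copy indices, one edge joins the vertex of $D^a_{k-1,n}$ with $uid_{k-1}=b-1$ to the vertex of $D^b_{k-1,n}$ with $uid_{k-1}=a$. An edge set $F$ is an $m$-restricted edge-cut of $G$ if $G-F$ is disconnected and every component has at least $m$ vertices; $G$ is super-$\lambda_m$ if every minimum $m$-restricted edge-cut isolates a connected subgraph on exactly $m$ vertices. -}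

module Defs where

open import Data.Nat using (ℕ; zero; suc; _+_; _*_; _<_; _≤_; _≡ᵇ_; _<ᵇ_; _/_; _%_)
open import Data.Nat.Properties using ()
open import Data.Bool using (Bool; true; false; _∧_; _∨_; not; if_then_else_; T)
open import Data.Fin using (Fin; toℕ)
open import Data.List using (List; []; _∷_; length; allFin; map; concatMap)
open import Data.List.Relation.Unary.All using (All)
open import Data.List.Relation.Unary.Unique.Propositional using (Unique)
open import Data.Product using (Σ; _×_; _,_; ∃; proj₁; proj₂)
open import Data.Sum using (_⊎_)
open import Relation.Binary.PropositionalEquality using (_≡_)
open import Relation.Binary.Construct.Closure.ReflexiveTransitive using (Star)
open import Relation.Nullary using (¬_)
open import Relation.Unary using (Pred)

t : ℕ → ℕ → ℕ
t zero    n = n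
t (suc k) n = t k n * (t k n + 1)

-- Vertices of D_{k,n} are identified with their index uid_k ∈ {0,…,t k n - 1}.
-- Since uid_k(a_k,…,a_0) = a_k * t_{k-1,n} + uid_{k-1}(a_{k-1},…,a_0),
-- a vertex with index u of D_{k+1,n} lies in copy u / t k n with
-- index u % t k n inside that copy.
-- dcellAdj k n u v : adjacency in D_{k,n} of the vertices with indices u, v.
dcellAdj : ℕ → ℕ → ℕ → ℕ → Bool
dcellAdj zero    n u v = not (u ≡ᵇ v)
dcellAdj (suc k) n u v with t k n
... | zero    = false                                 -- (impossible for n ≥ 1)
... | suc T-1 =
  let T = suc T-1
      a = u / T ; x = u % T
      b = v / T ; y = v % T
  in if a ≡ᵇ b then dcellAdj k n x y
     else if a <ᵇ b then ((x ≡ᵇ (b Data.Nat.∸ 1)) ∧ (y ≡ᵇ a))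
     else ((y ≡ᵇ (a Data.Nat.∸ 1)) ∧ (x ≡ᵇ b))

V : ℕ → ℕ → Set
V k n = Fin (t k n)

Adj : (k n : ℕ) → V k n → V k n → Bool
Adj k n u v = dcellAdj k n (toℕ u) (toℕ v)

-- An edge set F of D_{k,n}: given by a Boolean function on vertex pairs;
-- the edge {u,v} belongs to F iff  Adj u v  and  F u v = true  where
-- the pair is taken in increasing order of index (F on other pairs is ignored).
EdgeSet : ℕ → ℕ → Set
EdgeSet k n = V k n → V k n → Bool

inF : (k n : ℕ) → EdgeSet k n → V k n → V k n → Bool
inF k n F u v =
  Adj k n u v ∧ (if toℕ u <ᵇ toℕ v then F u v else F v u)

countB : {A : Set} → (A → Bool) → List A → ℕ
countB p []       = 0
countB p (x ∷ xs) = if p x then suc (countB p xs) else countB p xs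

card : (k n : ℕ) → EdgeSet k n → ℕ
card k n F =
  countB (λ p → (toℕ (proj₁ p) <ᵇ toℕ (proj₂ p)) ∧ inF k n F (proj₁ p) (proj₂ p))
         (concatMap (λ u → map (λ v → (u , v)) (allFin (t k n))) (allFin (t k n)))

AdjMinus : (k n : ℕ) → EdgeSet k n → V k n → V k n → Set
AdjMinus k n F u v = T (Adj k n u v ∧ not (inF k n F u v))

Reach : (k n : ℕ) → EdgeSet k n → V k n → V k n → Set
Reach k n F = Star (AdjMinus k n F)

IsRestrictedCut : (m k n : ℕ) → EdgeSet k n → Set
IsRestrictedCut m k n F =
  (∃ λ (u : V k n) → ∃ λ (v : V k n) → ¬ Reach k n F u v) ×
  (∀ (u : V k n) → ∃ λ (vs : List (V k n)) →
          m ≤ length vs × Unique vs × All (Reach k n F u) vs)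

IsMinRestrictedCut : (m k n : ℕ) → EdgeSet k n → Set
IsMinRestrictedCut m k n F =
  IsRestrictedCut m k n F ×
  (∀ (F' : EdgeSet k n) → IsRestrictedCut m k n F' → card k n F ≤ card k n F')

HasTwoVertexComponent : (k n : ℕ) → EdgeSet k n → Set
HasTwoVertexComponent k n F =
  ∃ λ (u : V k n) → ∃ λ (v : V k n) →
    AdjMinus k n F u v × (∀ w → Reach k n F u w → w ≡ u ⊎ w ≡ v)

{-# OPTIONS --safe #-}
-- Let ∂ S be the number of edges leaving S and δ the degree n + k - 1. By induction on k, a nonempty proper S has
-- ∂ S ≥ δ, and ∂ S + |S| ≥ 2δ if moreover |S| ≥ 2, which sharpens to ∂ S + |S| > 2δ if |S| ≥ 3 and k ≥ 2 or
-- k = 1, n = 2. Hence, one level up, ∂ S > 2δ - 2 when S and its complement both have at least 3 vertices.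
-- Each time one looks at the copies of D_{k-1,n} met by S. For ∂ S + |S|, a copy contained in S makes |S| large enough. For ∂ S, if S contains one
-- copy and misses another, the edges joining pairs of copies suffice; otherwise S or its complement contains no copy.
-- If S contains no copy, each copy that it meets contributes at least δ - 1 by induction, and if S lies in one copy
-- then each of its vertices also sends an edge out of that copy.
-- Isolating an edge costs only 2δ - 2, so a minimum cut must leave a component with two vertices: otherwise
-- two vertices that it separates have components with at least 3 vertices each, and the cut has more than 2δ - 2 edges.
module Submission where

open import Defs
open import Data.Bool
  using (Bool; true; false; _∧_; _∨_; _xor_; not; if_then_else_; T) renaming (_≟_ to _≟ᵇ_; T? to T?)
open import Data.Bool.Properties using (not-involutive; T-≡; ∧-zeroʳ; ∧-comm; xor-comm; xor-same; ¬-not)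
open import Data.Fin using (Fin; zero; suc; toℕ; cast; combine; punchIn; punchOut; fromℕ<; remQuot; _↑ˡ_; _↑ʳ_)
open import Data.Fin.Properties
  using (_≟_; any?; toℕ-cast; toℕ-combine; toℕ<n; toℕ-injective; toℕ-fromℕ<; punchInᵢ≢i;
         punchIn-injective; punchIn-punchOut; combine-remQuot; cast-involutive)
open import Data.List using (List; []; _∷_; _++_; map; concatMap; tabulate; allFin; length)
open import Data.List.Properties using (map-tabulate)
open import Data.List.Relation.Unary.All using (All; []; _∷_)
open import Data.List.Relation.Unary.AllPairs using ([]; _∷_)
open import Data.List.Relation.Unary.Unique.Propositional using (Unique)
open import Data.Nat
  using (ℕ; zero; suc; _+_; _*_; _∸_; _≤_; _<_; _≥_; z≤n; s≤s; _≡ᵇ_; _<ᵇ_; _/_; _%_; NonZero) renaming (_≟_ to _≟ₙ_)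
open import Data.Nat.DivMod using ([m+kn]%n≡m%n; m<n⇒m%n≡m; m<n⇒m/n≡0; m*n/n≡m; +-distrib-/-∣ʳ)
open import Data.Nat.Divisibility using (divides-refl)
open import Data.Nat.Properties hiding (_≟_)
open import Data.Nat.Tactic.RingSolver using (solve-∀)
open import Data.Product using (_×_; _,_; ∃; proj₁; proj₂)
open import Data.Sum using (_⊎_; inj₁; inj₂)
open import Function using (_∘_)
open import Function.Bundles using (Equivalence)
open import Relation.Binary.Construct.Closure.ReflexiveTransitive using (Star; ε; _◅_; _◅◅_; reverse)
open import Relation.Binary.Definitions using (tri<; tri≈; tri>)
open import Relation.Binary.PropositionalEquality
  using (_≡_; _≢_; refl; sym; trans; cong; cong₂; subst; ≢-sym; module ≡-Reasoning)
open import Relation.Nullary using (¬_; yes; no; contradiction; does; ¬?; _×-dec_)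
open import Relation.Nullary.Decidable using (dec-true; dec-false)
open import Algebra.Properties.Semiring.Sum +-*-semiring
  using (sum; sum-cong-≗; sum-remove; ∑-comm; ∑-distrib-+; sum-replicate-zero; *-distribˡ-sum; *-distribʳ-sum)

private variable
  m n : ℕ

-- Sums over Fin n and cardinalities of subsets

sum-mono : {f g : Fin n → ℕ} → (∀ i → f i ≤ g i) → sum f ≤ sum g
sum-mono {zero}  f≤g = z≤n
sum-mono {suc n} f≤g = +-mono-≤ (f≤g zero) (sum-mono (f≤g ∘ suc))

n≤sum : {f : Fin n → ℕ} → (∀ i → 1 ≤ f i) → n ≤ sum f
n≤sum {zero}  1≤f = z≤n
n≤sum {suc n} 1≤f = +-mono-≤ (1≤f zero) (n≤sum (1≤f ∘ suc))

sum-zero : {f : Fin n → ℕ} → (∀ i → f i ≡ 0) → sum f ≡ 0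
sum-zero {n} f≡0 = trans (sum-cong-≗ f≡0) (sum-replicate-zero n)

term≤sum : (f : Fin n → ℕ) (i : Fin n) → f i ≤ sum f
term≤sum {suc n} f i = ≤-trans (m≤m+n _ _) (≤-reflexive (sym (sum-remove {i = i} f)))

sum-positive : (f : Fin n → ℕ) → 1 ≤ sum f → ∃ λ i → 1 ≤ f i
sum-positive f 1≤f with any? (λ i → 1 ≤? f i)
... | yes i+ = i+
... | no ¬i+ = contradiction (subst (1 ≤_) (sum-zero λ i → n<1⇒n≡0 (≰⇒> λ 1≤ → ¬i+ (i , 1≤))) 1≤f) (n≮n 0)

two≤sum : (f : Fin n → ℕ) {i j : Fin n} → i ≢ j → f i + f j ≤ sum f
two≤sum {suc n} f {i} {j} i≢j = begin
  f i + f j                             ≡⟨ cong (λ l → f i + f l) (punchIn-punchOut i≢j) ⟨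
  f i + f (punchIn i (punchOut i≢j))    ≤⟨ +-monoʳ-≤ (f i) (term≤sum (f ∘ punchIn i) (punchOut i≢j)) ⟩
  f i + sum (f ∘ punchIn i)             ≡⟨ sum-remove {i = i} f ⟨
  sum f                                 ∎
  where open ≤-Reasoning

punchOut-≢ : {i j l : Fin (suc n)} (i≢j : i ≢ j) (i≢l : i ≢ l) → j ≢ l → punchOut i≢j ≢ punchOut i≢l
punchOut-≢ {i = i} i≢j i≢l j≢l eq =
  j≢l (trans (sym (punchIn-punchOut i≢j)) (trans (cong (punchIn i) eq) (punchIn-punchOut i≢l)))

three≤sum : (f : Fin n → ℕ) {i j l : Fin n} → i ≢ j → i ≢ l → j ≢ l → f i + (f j + f l) ≤ sum f
three≤sum {suc n} f {i} {j} {l} i≢j i≢l j≢l = begin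
  f i + (f j + f l)
    ≡⟨ cong₂ (λ a b → f i + (f a + f b)) (punchIn-punchOut i≢j) (punchIn-punchOut i≢l) ⟨
  f i + (f (punchIn i (punchOut i≢j)) + f (punchIn i (punchOut i≢l)))
    ≤⟨ +-monoʳ-≤ (f i) (two≤sum (f ∘ punchIn i) (punchOut-≢ i≢j i≢l j≢l)) ⟩
  f i + sum (f ∘ punchIn i)
    ≡⟨ sum-remove {i = i} f ⟨
  sum f ∎
  where open ≤-Reasoning

sum-single : (f : Fin n → ℕ) (i : Fin n) → (∀ j → j ≢ i → f j ≡ 0) → sum f ≡ f i
sum-single {suc n} f i f≡0 = begin
  sum f                      ≡⟨ sum-remove {i = i} f ⟩
  f i + sum (f ∘ punchIn i)  ≡⟨ cong (f i +_) (sum-zero λ x → f≡0 _ (punchInᵢ≢i i x)) ⟩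
  f i + 0                    ≡⟨ +-identityʳ (f i) ⟩
  f i                        ∎
  where open ≡-Reasoning

sum-pair : (f : Fin n → ℕ) {i j : Fin n} → i ≢ j → (∀ l → l ≢ i → l ≢ j → f l ≡ 0) → sum f ≡ f i + f j
sum-pair {suc n} f {i} {j} i≢j f≡0 = begin
  sum f                               ≡⟨ sum-remove {i = i} f ⟩
  f i + sum (f ∘ punchIn i)           ≡⟨ cong (f i +_) (sum-single (f ∘ punchIn i) (punchOut i≢j) rest) ⟩
  f i + f (punchIn i (punchOut i≢j))  ≡⟨ cong (λ l → f i + f l) (punchIn-punchOut i≢j) ⟩
  f i + f j                           ∎
  where
  open ≡-Reasoning
  rest : ∀ x → x ≢ punchOut i≢j → f (punchIn i x) ≡ 0
  rest x x≢ = f≡0 _ (punchInᵢ≢i i x) λ eq →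
    x≢ (punchIn-injective i x _ (trans eq (sym (punchIn-punchOut i≢j))))

sum-cast : .(eq : m ≡ n) (f : Fin n → ℕ) → sum f ≡ sum (f ∘ cast eq)
sum-cast {zero}  {zero}  eq f = refl
sum-cast {suc m} {suc n} eq f = cong (f zero +_) (sum-cast (suc-injective eq) (f ∘ suc))

sum-++ : ∀ m (f : Fin (m + n) → ℕ) → sum f ≡ sum (f ∘ (_↑ˡ n)) + sum (f ∘ (m ↑ʳ_))
sum-++ zero    f = refl
sum-++ (suc m) f = trans (cong (f zero +_) (sum-++ m (f ∘ suc))) (sym (+-assoc (f zero) _ _))

sum-combine : ∀ m (f : Fin (m * n) → ℕ) → sum f ≡ sum λ i → sum λ j → f (combine {m} i j)
sum-combine     zero    f = refl
sum-combine {n} (suc m) f = trans (sum-++ n f) (cong (sum (f ∘ (_↑ˡ (m * n))) +_) (sum-combine m (f ∘ (n ↑ʳ_))))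

𝟙 : Bool → ℕ
𝟙 b = if b then 1 else 0

𝟙-mono : ∀ {a b} → (a ≡ true → b ≡ true) → 𝟙 a ≤ 𝟙 b
𝟙-mono {false} h = z≤n
𝟙-mono {true}  h rewrite h refl = ≤-refl

𝟙≡0 : ∀ {b} → 𝟙 b ≡ 0 → b ≡ false
𝟙≡0 {false} _ = refl

𝟙-not : ∀ b → 𝟙 b + 𝟙 (not b) ≡ 1
𝟙-not false = refl
𝟙-not true  = refl

size : (Fin n → Bool) → ℕ
size S = sum (𝟙 ∘ S)

∁ : (Fin n → Bool) → Fin n → Bool
∁ S = not ∘ S

size-∁∁ : (S : Fin n → Bool) → size (∁ (∁ S)) ≡ size S
size-∁∁ S = sum-cong-≗ λ i → cong 𝟙 (not-involutive (S i))

size+size-∁ : (S : Fin n → Bool) → size S + size (∁ S) ≡ n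
size+size-∁ {n} S = trans (sym (∑-distrib-+ (𝟙 ∘ S) (𝟙 ∘ ∁ S))) (trans (sum-cong-≗ λ i → 𝟙-not (S i)) (sum-one n))
  where
  sum-one : ∀ n → sum {n} (λ _ → 1) ≡ n
  sum-one zero    = refl
  sum-one (suc n) = cong suc (sum-one n)

size≡0 : (S : Fin n → Bool) → size S ≡ 0 → ∀ i → S i ≡ false
size≡0 S s≡0 i = 𝟙≡0 (n≤0⇒n≡0 (subst (_ ≤_) s≡0 (term≤sum (𝟙 ∘ S) i)))

size-∁≡0 : (S : Fin n → Bool) → size (∁ S) ≡ 0 → ∀ i → S i ≡ true
size-∁≡0 S s≡0 i = trans (sym (not-involutive (S i))) (cong not (size≡0 (∁ S) s≡0 i))

-- Edges inside and between the copies

≡ᵇ-refl : ∀ a → (a ≡ᵇ a) ≡ true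
≡ᵇ-refl zero    = refl
≡ᵇ-refl (suc a) = ≡ᵇ-refl a

≡ᵇ-sym : ∀ a b → (a ≡ᵇ b) ≡ (b ≡ᵇ a)
≡ᵇ-sym zero    zero    = refl
≡ᵇ-sym zero    (suc b) = refl
≡ᵇ-sym (suc a) zero    = refl
≡ᵇ-sym (suc a) (suc b) = ≡ᵇ-sym a b

≢⇒≡ᵇ : ∀ {a b} → a ≢ b → (a ≡ᵇ b) ≡ false
≢⇒≡ᵇ {zero}  {zero}  a≢b = contradiction refl a≢b
≢⇒≡ᵇ {zero}  {suc b} a≢b = refl
≢⇒≡ᵇ {suc a} {zero}  a≢b = refl
≢⇒≡ᵇ {suc a} {suc b} a≢b = ≢⇒≡ᵇ (a≢b ∘ cong suc)

<⇒<ᵇ≡true : ∀ {a b} → a < b → (a <ᵇ b) ≡ true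
<⇒<ᵇ≡true {zero}  {suc b} _         = refl
<⇒<ᵇ≡true {suc a} {suc b} (s≤s a<b) = <⇒<ᵇ≡true a<b

≤⇒<ᵇ≡false : ∀ {a b} → b ≤ a → (a <ᵇ b) ≡ false
≤⇒<ᵇ≡false {a}     {zero}  _         = refl
≤⇒<ᵇ≡false {suc a} {suc b} (s≤s b≤a) = ≤⇒<ᵇ≡false b≤a

∧-true⁻ : ∀ {a b} → a ∧ b ≡ true → a ≡ true × b ≡ true
∧-true⁻ {true} b≡true = refl , b≡true

-- The branch of `dcellAdj` for two different copies, with copy indices `a`, `b` and inner indices
-- `x`, `y` as free arguments, so that no quotient or remainder remains.
link : ℕ → ℕ → ℕ → ℕ → Bool
link a x b y = if a <ᵇ b then (x ≡ᵇ (b ∸ 1)) ∧ (y ≡ᵇ a) else (y ≡ᵇ (a ∸ 1)) ∧ (x ≡ᵇ b)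

link-sym : ∀ {a b} x y → a ≢ b → link a x b y ≡ link b y a x
link-sym {a} {b} x y a≢b with <-cmp a b
... | tri< a<b _ _ rewrite <⇒<ᵇ≡true a<b | ≤⇒<ᵇ≡false (<⇒≤ a<b) = refl
... | tri≈ _ a≡b _ = contradiction a≡b a≢b
... | tri> _ _ b<a rewrite <⇒<ᵇ≡true b<a | ≤⇒<ᵇ≡false (<⇒≤ b<a) = refl

dcellAdj-sym : ∀ k n u v → dcellAdj k n u v ≡ dcellAdj k n v u
dcellAdj-sym zero    n u v = cong not (≡ᵇ-sym u v)
dcellAdj-sym (suc k) n u v with t k n
... | zero  = refl
... | suc p = go (u / suc p) (v / suc p)
  where
  x = u % suc p
  y = v % suc p
  go : ∀ a b → (if a ≡ᵇ b then dcellAdj k n x y else link a x b y)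
             ≡ (if b ≡ᵇ a then dcellAdj k n y x else link b y a x)
  go a b with a ≟ₙ b
  ... | yes refl rewrite ≡ᵇ-refl a = dcellAdj-sym k n x y
  ... | no  a≢b  rewrite ≢⇒≡ᵇ a≢b | ≢⇒≡ᵇ (≢-sym a≢b) = link-sym x y a≢b

[n*a+x]/n≡a : ∀ n .{{_ : NonZero n}} a {x} → x < n → (n * a + x) / n ≡ a
[n*a+x]/n≡a n a {x} x<n = begin
  (n * a + x) / n      ≡⟨ cong (_/ n) (trans (+-comm (n * a) x) (cong (x +_) (*-comm n a))) ⟩
  (x + a * n) / n      ≡⟨ +-distrib-/-∣ʳ x (divides-refl a) ⟩
  x / n + a * n / n    ≡⟨ cong₂ _+_ (m<n⇒m/n≡0 x<n) (m*n/n≡m a n) ⟩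
  a                    ∎
  where open ≡-Reasoning

[n*a+x]%n≡x : ∀ n .{{_ : NonZero n}} a {x} → x < n → (n * a + x) % n ≡ x
[n*a+x]%n≡x n a {x} x<n = begin
  (n * a + x) % n  ≡⟨ cong (_% n) (trans (+-comm (n * a) x) (cong (x +_) (*-comm n a))) ⟩
  (x + a * n) % n  ≡⟨ [m+kn]%n≡m%n x a n ⟩
  x % n            ≡⟨ m<n⇒m%n≡m x<n ⟩
  x                ∎
  where open ≡-Reasoning

-- The left side is blocked on a match on `t k n`. The bounds exclude zero, and then quotient and
-- remainder recover copy and inner index.
dcellAdj-suc : ∀ k n a x b y → x < t k n → y < t k n →
  dcellAdj (suc k) n (t k n * a + x) (t k n * b + y) ≡ (if a ≡ᵇ b then dcellAdj k n x y else link a x b y)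
dcellAdj-suc k n a x b y x<T y<T with t k n | x<T | y<T
... | suc p | x<p | y<p
  rewrite [n*a+x]/n≡a (suc p) a x<p | [n*a+x]/n≡a (suc p) b y<p
        | [n*a+x]%n≡x (suc p) a x<p | [n*a+x]%n≡x (suc p) b y<p = refl

Adj-sym : ∀ k n u v → Adj k n u v ≡ Adj k n v u
Adj-sym k n u v = dcellAdj-sym k n (toℕ u) (toℕ v)

module _ (k n : ℕ) where

  copies*size : suc (t k n) * t k n ≡ t (suc k) n
  copies*size = trans (*-comm (suc (t k n)) (t k n)) (cong (t k n *_) (+-comm 1 (t k n)))

  -- `combine` numbers the vertices copy by copy, but its type has the two factors of `t (suc k) n`
  -- in the other order; hence the cast, which keeps the index.
  vertex : Fin (suc (t k n)) → V k n → V (suc k) n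
  vertex i x = cast copies*size (combine i x)

  toℕ-vertex : ∀ i x → toℕ (vertex i x) ≡ t k n * toℕ i + toℕ x
  toℕ-vertex i x = trans (toℕ-cast copies*size (combine i x)) (toℕ-combine i x)

  vertex-surjective : ∀ u → ∃ λ i → ∃ λ x → u ≡ vertex i x
  vertex-surjective u = proj₁ ix , proj₂ ix , (begin
    u                                            ≡⟨ cast-involutive copies*size (sym copies*size) u ⟨
    cast copies*size (cast (sym copies*size) u)  ≡⟨ cong (cast copies*size) (combine-remQuot {suc (t k n)} (t k n) _) ⟨
    vertex (proj₁ ix) (proj₂ ix)                 ∎)
    where
    open ≡-Reasoning
    ix = remQuot {suc (t k n)} (t k n) (cast (sym copies*size) u)

  sum-vertex : (f : V (suc k) n → ℕ) → sum f ≡ sum λ i → sum λ x → f (vertex i x)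
  sum-vertex f = trans (sum-cast copies*size f) (sum-combine (suc (t k n)) (f ∘ cast copies*size))

  Adj-vertex : ∀ i x j y → Adj (suc k) n (vertex i x) (vertex j y)
    ≡ (if toℕ i ≡ᵇ toℕ j then Adj k n x y else link (toℕ i) (toℕ x) (toℕ j) (toℕ y))
  Adj-vertex i x j y = trans (cong₂ (dcellAdj (suc k) n) (toℕ-vertex i x) (toℕ-vertex j y))
    (dcellAdj-suc k n (toℕ i) (toℕ x) (toℕ j) (toℕ y) (toℕ<n x) (toℕ<n y))

  Adj-inside : ∀ i x y → Adj (suc k) n (vertex i x) (vertex i y) ≡ Adj k n x y
  Adj-inside i x y rewrite Adj-vertex i x i y | ≡ᵇ-refl (toℕ i) = refl

toℕ-punchIn-< : (i : Fin (suc n)) (x : Fin n) → toℕ x < toℕ i → toℕ (punchIn i x) ≡ toℕ x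
toℕ-punchIn-< (suc i) zero    _         = refl
toℕ-punchIn-< (suc i) (suc x) (s≤s x<i) = cong suc (toℕ-punchIn-< i x x<i)

toℕ-punchIn-≥ : (i : Fin (suc n)) (x : Fin n) → toℕ i ≤ toℕ x → toℕ (punchIn i x) ≡ suc (toℕ x)
toℕ-punchIn-≥ zero    x       _         = refl
toℕ-punchIn-≥ (suc i) (suc x) (s≤s i≤x) = cong suc (toℕ-punchIn-≥ i x i≤x)

-- The vertex x of copy i is joined to copy x + 1 if i ≤ x and to copy x if x < i, that is, to copy punchIn i x.
Adj-across : ∀ k n i x → ∃ λ y → Adj (suc k) n (vertex k n i x) (vertex k n (punchIn i x) y) ≡ true
Adj-across k n i x with toℕ x <? toℕ i
... | yes x<i = y , (begin
  Adj (suc k) n (vertex k n i x) (vertex k n (punchIn i x) y)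
    ≡⟨ Adj-vertex k n i x (punchIn i x) y ⟩
  (if toℕ i ≡ᵇ toℕ (punchIn i x) then Adj k n x y else link (toℕ i) (toℕ x) (toℕ (punchIn i x)) (toℕ y))
    ≡⟨ cong₂ (λ b z → if toℕ i ≡ᵇ b then Adj k n x y else link (toℕ i) (toℕ x) b z) (toℕ-punchIn-< i x x<i) (toℕ-fromℕ< i-1<T) ⟩
  (if toℕ i ≡ᵇ toℕ x then Adj k n x y else link (toℕ i) (toℕ x) (toℕ x) (toℕ i ∸ 1))
    ≡⟨ linked ⟩
  true ∎)
  where
  open ≡-Reasoning
  i-1<T : toℕ i ∸ 1 < t k n
  i-1<T = ≤-trans (≤-reflexive (m+[n∸m]≡n {1} (≤-trans (s≤s z≤n) x<i))) (≤-pred (toℕ<n i))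
  y = fromℕ< i-1<T
  linked : (if toℕ i ≡ᵇ toℕ x then Adj k n x y else link (toℕ i) (toℕ x) (toℕ x) (toℕ i ∸ 1)) ≡ true
  linked rewrite ≢⇒≡ᵇ (≢-sym (<⇒≢ x<i)) | ≤⇒<ᵇ≡false (<⇒≤ x<i) | ≡ᵇ-refl (toℕ i ∸ 1) = ≡ᵇ-refl (toℕ x)
... | no  x≮i = y , (begin
  Adj (suc k) n (vertex k n i x) (vertex k n (punchIn i x) y)
    ≡⟨ Adj-vertex k n i x (punchIn i x) y ⟩
  (if toℕ i ≡ᵇ toℕ (punchIn i x) then Adj k n x y else link (toℕ i) (toℕ x) (toℕ (punchIn i x)) (toℕ y))
    ≡⟨ cong₂ (λ b z → if toℕ i ≡ᵇ b then Adj k n x y else link (toℕ i) (toℕ x) b z) (toℕ-punchIn-≥ i x i≤x) (toℕ-fromℕ< i<T) ⟩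
  (if toℕ i ≡ᵇ suc (toℕ x) then Adj k n x y else link (toℕ i) (toℕ x) (suc (toℕ x)) (toℕ i))
    ≡⟨ linked ⟩
  true ∎)
  where
  open ≡-Reasoning
  i≤x = ≮⇒≥ x≮i
  i<T : toℕ i < t k n
  i<T = ≤-<-trans i≤x (toℕ<n x)
  y = fromℕ< i<T
  linked : (if toℕ i ≡ᵇ suc (toℕ x) then Adj k n x y else link (toℕ i) (toℕ x) (suc (toℕ x)) (toℕ i)) ≡ true
  linked rewrite ≢⇒≡ᵇ (<⇒≢ (s≤s i≤x)) | <⇒<ᵇ≡true (s≤s i≤x) | ≡ᵇ-refl (toℕ x) = ≡ᵇ-refl (toℕ i)

-- Cuts and their decomposition over the copies

cut : (Fin n → Fin n → Bool) → (Fin n → Bool) → Fin n → Fin n → Bool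
cut A S u v = A u v ∧ (S u ∧ not (S v))

-- boundary A S counts the ordered pairs (u , v) with u ∈ S and v ∉ S, so that every edge of the cut is counted once.
boundary : (Fin n → Fin n → Bool) → (Fin n → Bool) → ℕ
boundary A S = sum λ u → sum λ v → 𝟙 (cut A S u v)

-- Transposing the double sum reverses every ordered pair, which turns the pairs leaving the
-- complement into those leaving `S`.
boundary-∁ : {A : Fin n → Fin n → Bool} → (∀ u v → A u v ≡ A v u) → ∀ S → boundary A (∁ S) ≡ boundary A S
boundary-∁ {A = A} A-sym S = trans (∑-comm λ u v → 𝟙 (cut A (∁ S) u v))
  (sum-cong-≗ λ v → sum-cong-≗ λ u → cong 𝟙 (cong₂ _∧_ (A-sym u v)
    (trans (∧-comm (not (S u)) _) (cong (_∧ not (S u)) (not-involutive (S v))))))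

∂ : ∀ k n → (V k n → Bool) → ℕ
∂ k n = boundary (Adj k n)

module Copies (k n : ℕ) (S : V (suc k) n → Bool) where

  copy : Fin (suc (t k n)) → V k n → Bool
  copy i x = S (vertex k n i x)

  crosses : Fin (suc (t k n)) → V k n → Fin (suc (t k n)) → V k n → ℕ
  crosses i x j y = 𝟙 (cut (Adj (suc k) n) S (vertex k n i x) (vertex k n j y))

  between : Fin (suc (t k n)) → Fin (suc (t k n)) → ℕ
  between i j = sum λ x → sum λ y → crosses i x j y

  -- Every pair of the cut is charged to the copy of its end in `S`; the other end may lie in any
  -- copy, `i` included.
  out : Fin (suc (t k n)) → ℕ
  out i = sum (between i)

  size-copies : size S ≡ sum (size ∘ copy)
  size-copies = sum-vertex k n (𝟙 ∘ S)

  ∂-copies : ∂ (suc k) n S ≡ sum out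
  ∂-copies = begin
    ∂ (suc k) n S
      ≡⟨ sum-vertex k n _ ⟩
    sum (λ i → sum λ x → sum λ v → 𝟙 (cut (Adj (suc k) n) S (vertex k n i x) v))
      ≡⟨ (sum-cong-≗ λ i → sum-cong-≗ λ x → sum-vertex k n λ v → 𝟙 (cut (Adj (suc k) n) S (vertex k n i x) v)) ⟩
    sum (λ i → sum λ x → sum λ j → sum λ y → crosses i x j y)
      ≡⟨ (sum-cong-≗ λ i → ∑-comm λ x j → sum (crosses i x j)) ⟩
    sum out ∎
    where open ≡-Reasoning

  between-diagonal : ∀ i → between i i ≡ ∂ k n (copy i)
  between-diagonal i = sum-cong-≗ λ x → sum-cong-≗ λ y →
    cong (λ a → 𝟙 (a ∧ (copy i x ∧ not (copy i y)))) (Adj-inside k n i x y)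

  ∂-copy≤out : ∀ i → ∂ k n (copy i) ≤ out i
  ∂-copy≤out i = subst (_≤ out i) (between-diagonal i) (term≤sum (between i) i)

  -- The edge leaving copy `i` at `x` leads to copy `punchIn i x`, and wherever it arrives there, it
  -- is outside `S`.
  between-across : ∀ i x → copy i x ≡ true → (∀ y → copy (punchIn i x) y ≡ false) → 1 ≤ between i (punchIn i x)
  between-across i x Sx ¬Sy with y , adj ← Adj-across k n i x = begin
    1                     ≡⟨ cong 𝟙 (cong₂ _∧_ adj (cong₂ _∧_ Sx (cong not (¬Sy y)))) ⟨
    crosses i x (punchIn i x) y        ≤⟨ term≤sum (crosses i x (punchIn i x)) y ⟩
    sum (crosses i x (punchIn i x))    ≤⟨ term≤sum (λ x′ → sum (crosses i x′ (punchIn i x))) x ⟩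
    between i (punchIn i x) ∎
    where open ≤-Reasoning

  -- Any two copies are joined by an edge; in copy `i` it starts at the vertex `punchOut i≢j`.
  between-full-empty : ∀ {i j} → i ≢ j → (∀ x → copy i x ≡ true) → (∀ y → copy j y ≡ false) → 1 ≤ between i j
  between-full-empty {i} {j} i≢j full empty = subst (λ l → 1 ≤ between i l) (punchIn-punchOut i≢j)
    (between-across i (punchOut i≢j) (full _) λ y → trans (cong (λ l → copy l y) (punchIn-punchOut i≢j)) (empty y))

  -- The edges from copy i into a copy punchIn i x with mark x ≥ 1 need not be counted, which is paid for by sum mark.
  out≥ : ∀ i (mark : V k n → ℕ) → (∀ x → size (copy (punchIn i x)) ≡ 0 ⊎ 1 ≤ mark x) →
    ∂ k n (copy i) + size (copy i) ≤ out i + sum mark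
  out≥ i mark empty∨mark = begin
    ∂ k n (copy i) + size (copy i)                       ≤⟨ +-mono-≤ (≤-reflexive (sym (between-diagonal i))) (sum-mono leaves) ⟩
    between i i + sum (λ x → between i (punchIn i x) + mark x) ≡⟨ cong (between i i +_) (∑-distrib-+ _ mark) ⟩
    between i i + (sum (between i ∘ punchIn i) + sum mark)  ≡⟨ +-assoc (between i i) _ _ ⟨
    between i i + sum (between i ∘ punchIn i) + sum mark    ≡⟨ cong (_+ sum mark) (sum-remove {i = i} (between i)) ⟨
    out i + sum mark                                        ∎
    where
    open ≤-Reasoning
    leaves : ∀ x → 𝟙 (copy i x) ≤ between i (punchIn i x) + mark x
    leaves x with copy i x in Sx | empty∨mark x
    ... | false | _       = z≤n
    ... | true  | inj₁ s≡0 = ≤-trans (between-across i x Sx (size≡0 _ s≡0)) (m≤m+n _ _)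
    ... | true  | inj₂ 1≤mark = ≤-trans 1≤mark (m≤n+m _ _)

-- Lower bounds on ∂

size-full : (S : Fin n → Bool) → size (∁ S) ≡ 0 → size S ≡ n
size-full S s≡0 = trans (sym (+-identityʳ (size S))) (trans (cong (size S +_) (sym s≡0)) (size+size-∁ S))

-- The step from level `k` to level `suc k`. Here `δ` stands for the degree at level `k`, known to
-- bound the edge connectivity from below.
module Splitting (k n δ : ℕ) (1≤δ : 1 ≤ δ)
  (δ≤∂ : ∀ S → 1 ≤ size S → 1 ≤ size (∁ S) → δ ≤ ∂ k n S) where

  open Copies k n

  NoFull : (V (suc k) n → Bool) → Set
  NoFull S = ∀ i → 1 ≤ size (∁ (copy S i))

  -- The number of copies that `S` meets: `one` and `two` record that all other copies are empty,
  -- whereas `three` means at least three.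
  data Occupied (S : V (suc k) n → Bool) : Set where
    one   : ∀ i → (∀ j → j ≢ i → size (copy S j) ≡ 0) → Occupied S
    two   : ∀ i j → i ≢ j → 1 ≤ size (copy S i) → 1 ≤ size (copy S j) →
            (∀ l → l ≢ i → l ≢ j → size (copy S l) ≡ 0) → Occupied S
    three : ∀ i j l → i ≢ j → i ≢ l → j ≢ l →
            1 ≤ size (copy S i) → 1 ≤ size (copy S j) → 1 ≤ size (copy S l) → Occupied S

  occupied : ∀ S → 1 ≤ size S → Occupied S
  occupied S 1≤S with i , i+ ← sum-positive (size ∘ copy S) (subst (1 ≤_) (size-copies S) 1≤S)
    with any? (λ j → (¬? (j ≟ i)) ×-dec (1 ≤? size (copy S j)))
  ... | no ¬j = one i λ j j≢i → n<1⇒n≡0 (≰⇒> λ j+ → ¬j (j , j≢i , j+))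
  ... | yes (j , j≢i , j+) with any? (λ l → (¬? (l ≟ i)) ×-dec ((¬? (l ≟ j)) ×-dec (1 ≤? size (copy S l))))
  ...   | no ¬l = two i j (≢-sym j≢i) i+ j+ λ l l≢i l≢j → n<1⇒n≡0 (≰⇒> λ l+ → ¬l (l , l≢i , l≢j , l+))
  ...   | yes (l , l≢i , l≢j , l+) = three i j l (≢-sym j≢i) (≢-sym l≢i) (≢-sym l≢j) i+ j+ l+

  module _ (S : V (suc k) n → Bool) where

    δ≤out : ∀ i → 1 ≤ size (copy S i) → 1 ≤ size (∁ (copy S i)) → δ ≤ out S i
    δ≤out i i+ i- = ≤-trans (δ≤∂ (copy S i) i+ i-) (∂-copy≤out S i)

    -- Each of the `t k n` copies `l` other than `i` yields its own edge of the cut: the edge from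
    -- `i` to `l` if `l` is empty, the edge from `l` to `j` if `l` is full, and an edge inside `l`
    -- otherwise. The first kind is counted in `out S i`, the others in `out S l`, so none is
    -- counted twice.
    full∧empty⇒t≤∂ : ∀ i j → size (∁ (copy S i)) ≡ 0 → size (copy S j) ≡ 0 → t k n ≤ ∂ (suc k) n S
    full∧empty⇒t≤∂ i j i-full j-empty = begin
      t k n                                                        ≤⟨ n≤sum through ⟩
      sum (λ x → between S i (punchIn i x) + out S (punchIn i x))  ≡⟨ ∑-distrib-+ (between S i ∘ punchIn i) _ ⟩
      sum (between S i ∘ punchIn i) + sum (out S ∘ punchIn i)      ≤⟨ +-monoˡ-≤ _ (m≤n+m _ (between S i i)) ⟩
      between S i i + sum (between S i ∘ punchIn i) + sum (out S ∘ punchIn i)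
                                                                   ≡⟨ cong (_+ sum (out S ∘ punchIn i)) (sum-remove {i = i} (between S i)) ⟨
      out S i + sum (out S ∘ punchIn i)                            ≡⟨ sum-remove {i = i} (out S) ⟨
      sum (out S)                                                  ≡⟨ ∂-copies S ⟨
      ∂ (suc k) n S                                                ∎
      where
      open ≤-Reasoning
      through : ∀ x → 1 ≤ between S i (punchIn i x) + out S (punchIn i x)
      through x with size (copy S (punchIn i x)) ≟ₙ 0 | size (∁ (copy S (punchIn i x))) ≟ₙ 0
      ... | yes l-empty | _ = ≤-trans
        (between-full-empty S (≢-sym (punchInᵢ≢i i x)) (size-∁≡0 (copy S i) i-full) (size≡0 _ l-empty))
        (m≤m+n (between S i (punchIn i x)) (out S (punchIn i x)))
      ... | no _ | yes l-full = ≤-trans (≤-trans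
        (between-full-empty S l≢j (size-∁≡0 _ l-full) (size≡0 (copy S j) j-empty))
        (term≤sum (between S (punchIn i x)) j))
        (m≤n+m (out S (punchIn i x)) (between S i (punchIn i x)))
        where
        l≢j : punchIn i x ≢ j
        l≢j l≡j with () ← trans (sym (size-∁≡0 (copy S (punchIn i x)) l-full x))
                                (size≡0 _ (trans (cong (size ∘ copy S) l≡j) j-empty) x)
      ... | no l+ | no l- = ≤-trans (≤-trans 1≤δ (δ≤out (punchIn i x) (n≢0⇒n>0 l+) (n≢0⇒n>0 l-)))
        (m≤n+m (out S (punchIn i x)) (between S i (punchIn i x)))

    size-one : ∀ i → (∀ j → j ≢ i → size (copy S j) ≡ 0) → size S ≡ size (copy S i)
    size-one i rest = trans (size-copies S) (sum-single (size ∘ copy S) i rest)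

    ∂-one : ∀ i → (∀ j → j ≢ i → size (copy S j) ≡ 0) → ∂ k n (copy S i) + size S ≤ ∂ (suc k) n S
    ∂-one i rest = begin
      ∂ k n (copy S i) + size S           ≡⟨ cong (∂ k n (copy S i) +_) (size-one i rest) ⟩
      ∂ k n (copy S i) + size (copy S i)  ≤⟨ out≥ S i (λ _ → 0) (λ x → inj₁ (rest _ (punchInᵢ≢i i x))) ⟩
      out S i + sum {t k n} (λ _ → 0)     ≡⟨ trans (cong (out S i +_) (sum-zero {t k n} λ _ → refl)) (+-identityʳ _) ⟩
      out S i                             ≤⟨ term≤sum (out S) i ⟩
      sum (out S)                         ≡⟨ ∂-copies S ⟨
      ∂ (suc k) n S                       ∎
      where open ≤-Reasoning

    module _ (noFull : NoFull S) where

      ∂-two : ∀ {i j} → i ≢ j → 1 ≤ size (copy S i) → 1 ≤ size (copy S j) → δ + δ ≤ ∂ (suc k) n S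
      ∂-two {i} {j} i≢j i+ j+ = begin
        δ + δ               ≤⟨ +-mono-≤ (δ≤out i i+ (noFull i)) (δ≤out j j+ (noFull j)) ⟩
        out S i + out S j   ≤⟨ two≤sum (out S) i≢j ⟩
        sum (out S)         ≡⟨ ∂-copies S ⟨
        ∂ (suc k) n S       ∎
        where open ≤-Reasoning

      ∂-three : ∀ {i j l} → i ≢ j → i ≢ l → j ≢ l →
        1 ≤ size (copy S i) → 1 ≤ size (copy S j) → 1 ≤ size (copy S l) → δ + (δ + δ) ≤ ∂ (suc k) n S
      ∂-three {i} {j} {l} i≢j i≢l j≢l i+ j+ l+ = begin
        δ + (δ + δ)                     ≤⟨ +-mono-≤ (δ≤out i i+ (noFull i)) (+-mono-≤ (δ≤out j j+ (noFull j)) (δ≤out l l+ (noFull l))) ⟩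
        out S i + (out S j + out S l)   ≤⟨ three≤sum (out S) i≢j i≢l j≢l ⟩
        sum (out S)                     ≡⟨ ∂-copies S ⟨
        ∂ (suc k) n S                   ∎
        where open ≤-Reasoning

      -- Only the vertex `p` of copy `i` has its outer edge going to the other occupied copy `j`.
      -- Marking `p` alone costs the 1 on the right.
      δ+size≤out : ∀ {i j} → i ≢ j → 1 ≤ size (copy S i) → (∀ l → l ≢ i → l ≢ j → size (copy S l) ≡ 0) →
        δ + size (copy S i) ≤ out S i + 1
      δ+size≤out {i} {j} i≢j i+ rest = begin
        δ + size (copy S i)                 ≤⟨ +-monoˡ-≤ _ (δ≤∂ (copy S i) i+ (noFull i)) ⟩
        ∂ k n (copy S i) + size (copy S i)  ≤⟨ out≥ S i mark others ⟩
        out S i + sum mark                  ≡⟨ cong (out S i +_) (sum-single mark p mark-≢) ⟩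
        out S i + mark p                    ≡⟨ cong (out S i +_) mark-p ⟩
        out S i + 1                         ∎
        where
        open ≤-Reasoning
        p : V k n
        p = punchOut i≢j
        mark : V k n → ℕ
        mark x = 𝟙 (does (x ≟ p))
        mark-p : mark p ≡ 1
        mark-p = cong 𝟙 (dec-true (p ≟ p) refl)
        mark-≢ : ∀ x → x ≢ p → mark x ≡ 0
        mark-≢ x x≢p = cong 𝟙 (dec-false (x ≟ p) x≢p)
        others : ∀ x → size (copy S (punchIn i x)) ≡ 0 ⊎ 1 ≤ mark x
        others x with x ≟ p
        ... | yes _  = inj₂ ≤-refl
        ... | no x≢p = inj₁ (rest _ (punchInᵢ≢i i x) λ eq →
          x≢p (punchIn-injective i x p (trans eq (sym (punchIn-punchOut i≢j)))))

      -- The two occupied copies are joined by a single edge. It may be missing from the cut, and it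
      -- is written off once at each end, hence the 2.
      ∂-two-only : ∀ {i j} → i ≢ j → 1 ≤ size (copy S i) → 1 ≤ size (copy S j) →
        (∀ l → l ≢ i → l ≢ j → size (copy S l) ≡ 0) → δ + δ + size S ≤ ∂ (suc k) n S + 2
      ∂-two-only {i} {j} i≢j i+ j+ rest = begin
        δ + δ + size S
          ≡⟨ cong (δ + δ +_) (trans (size-copies S) (sum-pair (size ∘ copy S) i≢j rest)) ⟩
        δ + δ + (size (copy S i) + size (copy S j))
          ≡⟨ interchange δ (size (copy S i)) (size (copy S j)) ⟩
        (δ + size (copy S i)) + (δ + size (copy S j))
          ≤⟨ +-mono-≤ (δ+size≤out i≢j i+ rest) (δ+size≤out (≢-sym i≢j) j+ λ l l≢j l≢i → rest l l≢i l≢j) ⟩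
        (out S i + 1) + (out S j + 1)
          ≡⟨ collect (out S i) (out S j) ⟩
        out S i + out S j + 2
          ≤⟨ +-monoˡ-≤ 2 (two≤sum (out S) i≢j) ⟩
        sum (out S) + 2
          ≡⟨ cong (_+ 2) (∂-copies S) ⟨
        ∂ (suc k) n S + 2 ∎
        where
        open ≤-Reasoning
        interchange : ∀ a b c → a + a + (b + c) ≡ (a + b) + (a + c)
        interchange = solve-∀
        collect : ∀ a b → (a + 1) + (b + 1) ≡ a + b + 2
        collect = solve-∀

  full-or-not : ∀ S → (∃ λ i → size (∁ (copy S i)) ≡ 0) ⊎ NoFull S
  full-or-not S with any? (λ i → size (∁ (copy S i)) ≟ₙ 0)
  ... | yes full = inj₁ full
  ... | no ¬full = inj₂ λ i → n≢0⇒n>0 λ i-full → ¬full (i , i-full)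

  -- A full and an empty copy already force ∂ S ≥ t k n; otherwise S or its complement contains no copy.
  wlog-noFull : ∀ b h → b ≤ t k n → (∀ S → h ≤ size S → NoFull S → b ≤ ∂ (suc k) n S) →
    ∀ S → h ≤ size S → h ≤ size (∁ S) → b ≤ ∂ (suc k) n S
  wlog-noFull b h b≤T bound S h≤S h≤∁S with full-or-not S | full-or-not (∁ S)
  ... | inj₂ noFull | _ = bound S h≤S noFull
  ... | inj₁ _ | inj₂ noEmpty =
    subst (b ≤_) (boundary-∁ (Adj-sym (suc k) n) S) (bound (∁ S) h≤∁S noEmpty)
  ... | inj₁ (i , i-full) | inj₁ (j , j-empty) =
    ≤-trans b≤T (full∧empty⇒t≤∂ S i j i-full (trans (sym (size-∁∁ (copy S j))) j-empty))

  -- If `S` lies in one copy, its outer edges add at least 1 to the `δ` edges inside; if it meets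
  -- two copies, it has at least `δ + δ` edges.
  edge-connected-suc : δ < t k n → ∀ S → 1 ≤ size S → 1 ≤ size (∁ S) → suc δ ≤ ∂ (suc k) n S
  edge-connected-suc δ<T = wlog-noFull (suc δ) 1 δ<T bound
    where
    2δ : ∀ {b} → δ + δ ≤ b → suc δ ≤ b
    2δ = ≤-trans (+-monoˡ-≤ δ 1≤δ)
    bound : ∀ S → 1 ≤ size S → NoFull S → suc δ ≤ ∂ (suc k) n S
    bound S 1≤S noFull with occupied S 1≤S
    ... | one i rest = ≤-trans (≤-reflexive (+-comm 1 δ)) (≤-trans
      (+-mono-≤ (δ≤∂ (copy S i) (subst (1 ≤_) (size-one S i rest) 1≤S) (noFull i)) 1≤S) (∂-one S i rest))
    ... | two i j i≢j i+ j+ _ = 2δ (∂-two S noFull i≢j i+ j+)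
    ... | three i j l i≢j _ _ i+ j+ _ = 2δ (∂-two S noFull i≢j i+ j+)

  -- The threshold `h` will be 2 for the weak bound and 3 for the strict one. A full copy gives
  -- `∂ S ≥ suc δ` and `|S| ≥ t k n`. Without a full copy, already `∂ S ≥ δ + δ`: from the
  -- hypothesis and the outer edges if `S` lies in one copy, and from two copies otherwise.
  size+∂-suc : δ < t k n →
    (∀ S → 2 ≤ size S → 1 ≤ size (∁ S) → δ + δ ≤ ∂ k n S + size S) →
    ∀ h → 2 ≤ h → δ + h ≤ suc (t k n) →
    ∀ S → h ≤ size S → 1 ≤ size (∁ S) → δ + δ + h ≤ ∂ (suc k) n S + size S
  size+∂-suc δ<T 2δ≤ h 2≤h δ+h≤ S h≤S 1≤∁S with full-or-not S
  ... | inj₁ (i , i-full) = begin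
    δ + δ + h                  ≡⟨ +-assoc δ δ h ⟩
    δ + (δ + h)                ≤⟨ +-monoʳ-≤ δ δ+h≤ ⟩
    δ + suc (t k n)            ≡⟨ +-suc δ (t k n) ⟩
    suc δ + t k n              ≤⟨ +-mono-≤ (edge-connected-suc δ<T S (≤-trans (s≤s z≤n) (≤-trans 2≤h h≤S)) 1≤∁S) T≤S ⟩
    ∂ (suc k) n S + size S     ∎
    where
    open ≤-Reasoning
    T≤S : t k n ≤ size S
    T≤S = begin
      t k n                   ≡⟨ size-full (copy S i) i-full ⟨
      size (copy S i)         ≤⟨ term≤sum (size ∘ copy S) i ⟩
      sum (size ∘ copy S)     ≡⟨ size-copies S ⟨
      size S                  ∎
  ... | inj₂ noFull with occupied S (≤-trans (s≤s z≤n) (≤-trans 2≤h h≤S))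
  ...   | one i rest = +-mono-≤ (≤-trans (subst (λ s → δ + δ ≤ ∂ k n (copy S i) + s) (sym (size-one S i rest))
    (2δ≤ (copy S i) (subst (2 ≤_) (size-one S i rest) (≤-trans 2≤h h≤S)) (noFull i))) (∂-one S i rest)) h≤S
  ...   | two i j i≢j i+ j+ _ = +-mono-≤ (∂-two S noFull i≢j i+ j+) h≤S
  ...   | three i j l i≢j _ _ i+ j+ _ = +-mono-≤ (∂-two S noFull i≢j i+ j+) h≤S

  -- One copy: the size in the hypothesis is paid by the outer edges. Two copies: `|S| ≥ 3`
  -- outweighs the loss of 2. Three or more: `3δ > 2δ`.
  ∂-suc-≥3 : suc (δ + δ) ≤ t k n →
    (∀ S → 3 ≤ size S → 1 ≤ size (∁ S) → suc (δ + δ) ≤ ∂ k n S + size S) →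
    ∀ S → 3 ≤ size S → 3 ≤ size (∁ S) → suc (δ + δ) ≤ ∂ (suc k) n S
  ∂-suc-≥3 2δ<T 2δ< = wlog-noFull (suc (δ + δ)) 3 2δ<T bound
    where
    bound : ∀ S → 3 ≤ size S → NoFull S → suc (δ + δ) ≤ ∂ (suc k) n S
    bound S 3≤S noFull with occupied S (≤-trans (s≤s z≤n) 3≤S)
    ... | one i rest = ≤-trans (subst (λ s → suc (δ + δ) ≤ ∂ k n (copy S i) + s) (sym (size-one S i rest))
      (2δ< (copy S i) (subst (3 ≤_) (size-one S i rest) 3≤S) (noFull i))) (∂-one S i rest)
    ... | two i j i≢j i+ j+ rest = +-cancelʳ-≤ 2 _ _ (begin
      suc (δ + δ) + 2     ≡⟨ +-suc (δ + δ) 2 ⟨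
      δ + δ + 3           ≤⟨ +-monoʳ-≤ (δ + δ) 3≤S ⟩
      δ + δ + size S      ≤⟨ ∂-two-only S noFull i≢j i+ j+ rest ⟩
      ∂ (suc k) n S + 2   ∎)
      where open ≤-Reasoning
    ... | three i j l i≢j i≢l j≢l i+ j+ l+ =
      ≤-trans (+-monoˡ-≤ (δ + δ) 1≤δ) (∂-three S noFull i≢j i≢l j≢l i+ j+ l+)

-- In a complete graph every pair with one vertex in `S` and one outside is an edge.
∂-complete : ∀ n (S : Fin n → Bool) → ∂ 0 n S ≡ size S * size (∁ S)
∂-complete n S = begin
  ∂ 0 n S                                          ≡⟨ (sum-cong-≗ λ u → sum-cong-≗ λ v → distinct u v) ⟩
  sum (λ u → sum λ v → 𝟙 (S u) * 𝟙 (not (S v)))    ≡⟨ (sum-cong-≗ λ u → *-distribˡ-sum (𝟙 (S u)) (𝟙 ∘ ∁ S)) ⟨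
  sum (λ u → 𝟙 (S u) * size (∁ S))                 ≡⟨ *-distribʳ-sum (size (∁ S)) (𝟙 ∘ S) ⟨
  size S * size (∁ S)                              ∎
  where
  open ≡-Reasoning
  distinct : ∀ u v → 𝟙 (cut (Adj 0 n) S u v) ≡ 𝟙 (S u) * 𝟙 (not (S v))
  distinct u v with u ≟ v
  -- On the diagonal both sides vanish: there are no loops, and `u` is not on both sides.
  ... | yes refl rewrite ≡ᵇ-refl (toℕ u) with S u
  ...   | true  = refl
  ...   | false = refl
  distinct u v | no u≢v rewrite ≢⇒≡ᵇ (u≢v ∘ toℕ-injective) with S u | S v
  ... | false | _     = refl
  ... | true  | false = refl
  ... | true  | true  = refl

-- The cut around the edge {0 , 1}

dcellAdj-irrefl : ∀ k n u → dcellAdj k n u u ≡ false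
dcellAdj-irrefl zero    n u = cong not (≡ᵇ-refl u)
dcellAdj-irrefl (suc k) n u with t k n
... | zero  = refl
... | suc p rewrite ≡ᵇ-refl (u / suc p) = dcellAdj-irrefl k n (u % suc p)

Adj⇒≢ : ∀ k n {u v} → Adj k n u v ≡ true → u ≢ v
Adj⇒≢ k n {u} adj refl with () ← trans (sym adj) (dcellAdj-irrefl k n (toℕ u))

boundary-cong : (A : Fin n → Fin n → Bool) {S S′ : Fin n → Bool} → (∀ u → S u ≡ S′ u) → boundary A S ≡ boundary A S′
boundary-cong A S≗S′ = sum-cong-≗ λ u → sum-cong-≗ λ v →
  cong (λ b → 𝟙 (A u v ∧ b)) (cong₂ (λ a b → a ∧ not b) (S≗S′ u) (S≗S′ v))

-- For `n ≥ 2` the indices 0 and 1 are, at every level, two adjacent vertices of the first copy of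
-- the complete graph.
pair : Fin n → Bool
pair u = toℕ u <ᵇ 2

size-pair : 2 ≤ n → size {n} pair ≡ 2
size-pair {suc (suc n)} _ = cong (2 +_) (sum-zero {n} λ _ → refl)
size-pair {suc zero} (s≤s ())

module PairCut (k n : ℕ) (2≤T : 2 ≤ t k n) where

  open Copies k n pair

  pair-zero : ∀ x → copy zero x ≡ pair x
  pair-zero x = cong (_<ᵇ 2) (trans (toℕ-vertex k n zero x) (cong (_+ toℕ x) (*-zeroʳ (t k n))))

  pair-suc : ∀ i x → copy (suc i) x ≡ false
  pair-suc i x = ≤⇒<ᵇ≡false (begin
    2                                ≤⟨ 2≤T ⟩
    t k n                            ≤⟨ m≤m*n (t k n) (suc (toℕ i)) ⟩
    t k n * suc (toℕ i)              ≤⟨ m≤m+n _ (toℕ x) ⟩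
    t k n * suc (toℕ i) + toℕ x      ≡⟨ toℕ-vertex k n (suc i) x ⟨
    toℕ (vertex k n (suc i) x)       ∎)
    where open ≤-Reasoning

  crosses-suc : ∀ i x j y → crosses (suc i) x j y ≡ 0
  crosses-suc i x j y rewrite pair-suc i x = cong 𝟙 (∧-zeroʳ _)

  out-suc : ∀ i → out (suc i) ≡ 0
  out-suc i = sum-zero λ j → sum-zero λ x → sum-zero λ y → crosses-suc i x j y

  -- The vertex at which the edge from copy 0 arrives in every other copy.
  origin : V k n
  origin = fromℕ< (≤-trans (s≤s z≤n) 2≤T)

  toℕ-origin : toℕ origin ≡ 0
  toℕ-origin = toℕ-fromℕ< (≤-trans (s≤s z≤n) 2≤T)

  Adj-zero-suc : ∀ x j y → Adj (suc k) n (vertex k n zero x) (vertex k n (suc j) y) ≡ (toℕ x ≡ᵇ toℕ j) ∧ (toℕ y ≡ᵇ 0)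
  Adj-zero-suc x j y = Adj-vertex k n zero x (suc j) y

  crosses-≢ˡ : ∀ {x j} y → x ≢ j → crosses zero x (suc j) y ≡ 0
  crosses-≢ˡ {x} {j} y x≢j rewrite Adj-zero-suc x j y | ≢⇒≡ᵇ (x≢j ∘ toℕ-injective) = refl

  crosses-≢ʳ : ∀ x j {y} → y ≢ origin → crosses zero x (suc j) y ≡ 0
  crosses-≢ʳ x j {y} y≢0 rewrite Adj-zero-suc x j y
    | ≢⇒≡ᵇ {toℕ y} {0} (λ eq → y≢0 (toℕ-injective (trans eq (sym toℕ-origin)))) | ∧-zeroʳ (toℕ x ≡ᵇ toℕ j) = refl

  -- Copy 0 has a single edge to copy `suc j`; it starts at `j`, so it is cut only if `j` belongs to
  -- the pair.
  between-zero-suc : ∀ j → between zero (suc j) ≤ 𝟙 (pair j)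
  between-zero-suc j = begin
    between zero (suc j)                     ≡⟨ sum-single (λ x → sum (crosses zero x (suc j))) j
                                                  (λ x x≢j → sum-zero λ y → crosses-≢ˡ y x≢j) ⟩
    sum (crosses zero j (suc j))             ≡⟨ sum-single (crosses zero j (suc j)) origin (λ y → crosses-≢ʳ j j) ⟩
    crosses zero j (suc j) origin            ≤⟨ 𝟙-mono (λ c → trans (sym (pair-zero j)) (in-pair c)) ⟩
    𝟙 (pair j)                               ∎
    where
    open ≤-Reasoning
    in-pair : cut (Adj (suc k) n) pair (vertex k n zero j) (vertex k n (suc j) origin) ≡ true → copy zero j ≡ true
    in-pair c = proj₁ (∧-true⁻ (proj₂ (∧-true⁻ {Adj (suc k) n (vertex k n zero j) (vertex k n (suc j) origin)} c)))

  -- Each of the two vertices gains one edge out of copy 0.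
  ∂-pair-suc : ∂ (suc k) n pair ≤ ∂ k n pair + 2
  ∂-pair-suc = begin
    ∂ (suc k) n pair                               ≡⟨ ∂-copies ⟩
    sum out                                        ≡⟨ sum-single out zero (λ { zero 0≢0 → contradiction refl 0≢0 ; (suc i) _ → out-suc i }) ⟩
    between zero zero + sum (between zero ∘ suc)   ≤⟨ +-mono-≤ (≤-reflexive (trans (between-diagonal zero) (boundary-cong (Adj k n) pair-zero)))
                                                        (sum-mono between-zero-suc) ⟩
    ∂ k n pair + size {t k n} pair                 ≡⟨ cong (∂ k n pair +_) (size-pair 2≤T) ⟩
    ∂ k n pair + 2                                 ∎
    where open ≤-Reasoning

neighbour : ∀ k {n} → 2 ≤ n → ∀ u → ∃ λ v → Adj k n u v ≡ true
neighbour zero (s≤s (s≤s z≤n)) zero    = suc zero , refl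
neighbour zero (s≤s (s≤s z≤n)) (suc u) = zero , refl
neighbour (suc k) {n} _ u with i , x , refl ← vertex-surjective k n u with y , adj ← Adj-across k n i x = _ , adj

-- Degree and order of the DCell for `n = 2 + m`, and the induction on k

degree : ℕ → ℕ → ℕ
degree m k = k + suc m

-- The three bounds are proved together: a new level adds 1 to the degree, while the order becomes
-- at least twice `t k n + 1`.
degree<t : ∀ m k → degree m k < t k (2 + m)
2≤t : ∀ m k → 2 ≤ t k (2 + m)
2t+2≤t : ∀ m k → 2 * (t k (2 + m) + 1) ≤ t (suc k) (2 + m)

2≤t m k = ≤-trans (s≤s (≤-trans (s≤s z≤n) (m≤n+m (suc m) k))) (degree<t m k)

2t+2≤t m k = *-monoˡ-≤ (t k (2 + m) + 1) (2≤t m k)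

degree<t m zero    = ≤-refl
degree<t m (suc k) = begin
  suc (suc (degree m k))      ≤⟨ s≤s (degree<t m k) ⟩
  suc (t k (2 + m))           ≡⟨ +-comm 1 _ ⟩
  t k (2 + m) + 1             ≤⟨ m≤n*m _ 2 ⟩
  2 * (t k (2 + m) + 1)       ≤⟨ 2t+2≤t m k ⟩
  t (suc k) (2 + m)           ∎
  where open ≤-Reasoning

-- Stated from level 1 on, since `2 (n - 1) < n` fails for a complete graph with `n ≥ 2`.
2degree<t : ∀ m k → degree m (suc k) + degree m (suc k) < t (suc k) (2 + m)
2degree<t m k = begin
  suc (suc δ + suc δ)      ≤⟨ s≤s (+-mono-≤ (degree<t m k) (degree<t m k)) ⟩
  suc (τ + τ)              ≤⟨ n≤1+n _ ⟩
  2 + (τ + τ)              ≡⟨ double τ ⟩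
  2 * (τ + 1)              ≤⟨ 2t+2≤t m k ⟩
  t (suc k) (2 + m)        ∎
  where
  open ≤-Reasoning
  δ = degree m k
  τ = t k (2 + m)
  double : ∀ a → 2 + (a + a) ≡ 2 * (a + 1)
  double = solve-∀

-- Isolating an edge costs at most `2δ - 2`; the 2 is moved to the left to avoid truncated
-- subtraction.
∂-pair : ∀ m k → ∂ k (2 + m) pair + 2 ≤ degree m k + degree m k
∂-pair m zero = ≤-reflexive (begin
  ∂ 0 (2 + m) pair + 2                             ≡⟨ cong (_+ 2) (∂-complete (2 + m) pair) ⟩
  size {2 + m} pair * size {2 + m} (∁ pair) + 2    ≡⟨ cong₂ (λ a b → a * b + 2) (size-pair 2≤n) size-∁pair ⟩
  2 * m + 2                                        ≡⟨ double m ⟩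
  suc m + suc m                                    ∎)
  where
  open ≡-Reasoning
  2≤n : 2 ≤ 2 + m
  2≤n = s≤s (s≤s z≤n)
  size-∁pair : size {2 + m} (∁ pair) ≡ m
  size-∁pair = +-cancelˡ-≡ 2 _ _ (trans (cong (_+ size {2 + m} (∁ pair)) (sym (size-pair 2≤n))) (size+size-∁ {2 + m} pair))
  double : ∀ a → 2 * a + 2 ≡ suc a + suc a
  double = solve-∀
∂-pair m (suc k) = begin
  ∂ (suc k) (2 + m) pair + 2            ≤⟨ +-monoˡ-≤ 2 (PairCut.∂-pair-suc k (2 + m) (2≤t m k)) ⟩
  ∂ k (2 + m) pair + 2 + 2              ≤⟨ +-monoˡ-≤ 2 (∂-pair m k) ⟩
  degree m k + degree m k + 2           ≡⟨ shift (degree m k) ⟩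
  degree m (suc k) + degree m (suc k)   ∎
  where
  open ≤-Reasoning
  shift : ∀ a → a + a + 2 ≡ suc a + suc a
  shift = solve-∀

1≤degree : ∀ m k → 1 ≤ degree m k
1≤degree m k = ≤-trans (s≤s z≤n) (m≤n+m (suc m) k)

edge-connected : ∀ m k S → 1 ≤ size S → 1 ≤ size (∁ S) → degree m k ≤ ∂ k (2 + m) S
edge-connected m zero S 1≤s 1≤c =
  subst (suc m ≤_) (sym (∂-complete (2 + m) S)) (product (size S) (size (∁ S)) 1≤s 1≤c (size+size-∁ S))
  where
  -- For positive factors, `s * c` is at least `s + c - 1`.
  product : ∀ s c → 1 ≤ s → 1 ≤ c → s + c ≡ 2 + m → suc m ≤ s * c
  product (suc a) (suc b) _ _ a+b = begin
    suc m              ≡⟨ suc-injective a+b ⟨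
    a + suc b          ≤⟨ +-monoˡ-≤ (suc b) (m≤m*n a (suc b)) ⟩
    a * suc b + suc b  ≡⟨ +-comm (a * suc b) (suc b) ⟩
    suc a * suc b      ∎
    where open ≤-Reasoning
edge-connected m (suc k) = Splitting.edge-connected-suc k (2 + m) (degree m k) (1≤degree m k) (edge-connected m k) (degree<t m k)

2degree≤∂+size : ∀ m k S → 2 ≤ size S → 1 ≤ size (∁ S) → degree m k + degree m k ≤ ∂ k (2 + m) S + size S
2degree≤∂+size m zero S 2≤s 1≤c = subst (λ e → suc m + suc m ≤ e + size S) (sym (∂-complete (2 + m) S))
  (product (size S) (size (∁ S)) 2≤s 1≤c (size+size-∁ S))
  where
  -- With `s = a + 2` and `c = b + 1` the two sides differ by exactly `a * b`.
  product : ∀ s c → 2 ≤ s → 1 ≤ c → s + c ≡ 2 + m → suc m + suc m ≤ s * c + s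
  product (suc (suc a)) (suc b) _ _ a+b rewrite sym (suc-injective (suc-injective a+b)) =
    ≤-trans (m≤m+n _ (a * b)) (≤-reflexive (expand a b))
    where
    expand : ∀ a b → suc (a + suc b) + suc (a + suc b) + a * b ≡ suc (suc a) * suc b + suc (suc a)
    expand = solve-∀
  product (suc zero) _ (s≤s ()) _ _
2degree≤∂+size m (suc k) S 2≤S 1≤∁S = subst (_≤ ∂ (suc k) (2 + m) S + size S) (shift (degree m k))
  (Splitting.size+∂-suc k (2 + m) (degree m k) (1≤degree m k) (edge-connected m k) (degree<t m k)
    (2degree≤∂+size m k) 2 ≤-refl (≤-trans (≤-reflexive (+-comm (degree m k) 2)) (s≤s (degree<t m k))) S 2≤S 1≤∁S)
  where
  shift : ∀ a → a + a + 2 ≡ suc a + suc a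
  shift = solve-∀

-- At level 1 with `n ≥ 3` the strict bound fails: a whole copy has `n` vertices and `n` outgoing
-- edges, and the degree is `n`. This is why the disjunction is assumed.
2degree<∂+size : ∀ m k → 1 ≤ k ⊎ m ≡ 0 → ∀ S → 3 ≤ size S → 1 ≤ size (∁ S) →
  suc (degree m (suc k) + degree m (suc k)) ≤ ∂ (suc k) (2 + m) S + size S
2degree<∂+size m (suc k) (inj₁ _) S 3≤S 1≤∁S = subst (_≤ ∂ (suc (suc k)) (2 + m) S + size S) (shift (degree m (suc k)))
  (Splitting.size+∂-suc (suc k) (2 + m) δ (1≤degree m (suc k)) (edge-connected m (suc k)) (degree<t m (suc k))
    (2degree≤∂+size m (suc k)) 3 (s≤s (s≤s z≤n)) δ+3≤ S 3≤S 1≤∁S)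
  where
  δ = degree m (suc k)
  shift : ∀ a → a + a + 3 ≡ suc (suc a + suc a)
  shift = solve-∀
  -- The condition on the threshold for `h = 3`; for a complete graph it would read `n + 2 ≤ n + 1`.
  δ+3≤ : δ + 3 ≤ suc (t (suc k) (2 + m))
  δ+3≤ = begin
    δ + 3                          ≡⟨ +-comm δ 3 ⟩
    3 + δ                          ≡⟨⟩
    suc (suc (1 + δ))              ≤⟨ s≤s (s≤s (+-monoˡ-≤ δ (1≤degree m (suc k)))) ⟩
    suc (suc (δ + δ))              ≤⟨ s≤s (2degree<t m k) ⟩
    suc (t (suc k) (2 + m))        ∎
    where open ≤-Reasoning
2degree<∂+size m zero (inj₂ refl) S 3≤S 1≤∁S =
  -- For `n = 2` level 1 is a 6-cycle of degree 2, and `2 + 3` exceeds `2 + 2`.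
  +-mono-≤ (edge-connected 0 1 S (≤-trans (s≤s z≤n) 3≤S) 1≤∁S) 3≤S
2degree<∂+size m (suc k) (inj₂ _) S = 2degree<∂+size m (suc k) (inj₁ (s≤s z≤n)) S

-- At level `2 + k` the degree is one more than `degree m (suc k)`, so this says that the cut
-- exceeds twice that degree minus 2.
2degree-2<∂ : ∀ m k → 1 ≤ k ⊎ m ≡ 0 → ∀ S → 3 ≤ size S → 3 ≤ size (∁ S) →
  suc (degree m (suc k) + degree m (suc k)) ≤ ∂ (suc (suc k)) (2 + m) S
2degree-2<∂ m k k,m = Splitting.∂-suc-≥3 (suc k) (2 + m) (degree m (suc k)) (1≤degree m (suc k))
  (edge-connected m (suc k)) (2degree<t m k) (2degree<∂+size m k k,m)

-- Edge sets and components

T⇒≡ : ∀ {b} → T b → b ≡ true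
T⇒≡ = Equivalence.to T-≡

≡⇒T : ∀ {b} → b ≡ true → T b
≡⇒T = Equivalence.from T-≡

countB-++ : {A : Set} (p : A → Bool) (xs ys : List A) → countB p (xs ++ ys) ≡ countB p xs + countB p ys
countB-++ p []       ys = refl
countB-++ p (x ∷ xs) ys with p x
... | true  = cong suc (countB-++ p xs ys)
... | false = countB-++ p xs ys

countB-tabulate : {A : Set} (p : A → Bool) (g : Fin n → A) → countB p (tabulate g) ≡ sum (𝟙 ∘ p ∘ g)
countB-tabulate {zero}  p g = refl
countB-tabulate {suc n} p g with p (g zero)
... | true  = cong suc (countB-tabulate p (g ∘ suc))
... | false = countB-tabulate p (g ∘ suc)

countB-concatMap : {A B : Set} (p : B → Bool) (f : A → List B) (g : Fin n → A) →
  countB p (concatMap f (tabulate g)) ≡ sum λ i → countB p (f (g i))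
countB-concatMap {zero}  p f g = refl
countB-concatMap {suc n} p f g = trans (countB-++ p (f (g zero)) _)
  (cong (countB p (f (g zero)) +_) (countB-concatMap p f (g ∘ suc)))

ordered : (Fin n → Fin n → Bool) → Fin n → Fin n → Bool
ordered E u v = (toℕ u <ᵇ toℕ v) ∧ E u v

card-sum : ∀ k n F → card k n F ≡ sum λ u → sum λ v → 𝟙 (ordered (inF k n F) u v)
card-sum k n F = trans
  (countB-concatMap p (λ u → map (u ,_) (allFin (t k n))) (λ u → u))
  (sum-cong-≗ λ u → trans (cong (countB p) (map-tabulate (λ v → v) (u ,_))) (countB-tabulate p (u ,_)))
  where
  p : V k n × V k n → Bool
  p (u , v) = ordered (inF k n F) u v

-- Each edge of the cut is counted once on either side: as a pair directed from S to its complement, or as a pair with u < v.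
boundary-ordered : {A : Fin n → Fin n → Bool} → (∀ u v → A u v ≡ A v u) → ∀ S →
  boundary A S ≡ sum λ u → sum λ v → 𝟙 (ordered (λ u v → A u v ∧ (S u xor S v)) u v)
boundary-ordered {n} {A} A-sym S = sym (begin
  sum (λ u → sum λ v → 𝟙 (ordered (λ u v → A u v ∧ (S u xor S v)) u v))
    ≡⟨ (sum-cong-≗ λ u → sum-cong-≗ λ v → split u v) ⟩
  sum (λ u → sum λ v → up u v + down v u)
    ≡⟨ (sum-cong-≗ λ u → ∑-distrib-+ (up u) (λ v → down v u)) ⟩
  sum (λ u → sum (up u) + sum λ v → down v u)
    ≡⟨ ∑-distrib-+ (λ u → sum (up u)) (λ u → sum λ v → down v u) ⟩
  sum (λ u → sum (up u)) + sum (λ u → sum λ v → down v u)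
    ≡⟨ cong (sum (λ u → sum (up u)) +_) (∑-comm λ u v → down v u) ⟩
  sum (λ u → sum (up u)) + sum (λ u → sum (down u))
    ≡⟨ ∑-distrib-+ (λ u → sum (up u)) (λ u → sum (down u)) ⟨
  sum (λ u → sum (up u) + sum (down u))
    ≡⟨ (sum-cong-≗ λ u → ∑-distrib-+ (up u) (down u)) ⟨
  sum (λ u → sum λ v → up u v + down u v)
    ≡⟨ (sum-cong-≗ λ u → sum-cong-≗ λ v → merge u v) ⟩
  boundary A S ∎)
  where
  open ≡-Reasoning
  up down : Fin n → Fin n → ℕ
  up   u v = 𝟙 ((toℕ u <ᵇ toℕ v) ∧ cut A S u v)
  down u v = 𝟙 ((toℕ v <ᵇ toℕ u) ∧ cut A S u v)
  split : ∀ u v → 𝟙 (ordered (λ u v → A u v ∧ (S u xor S v)) u v) ≡ up u v + down v u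
  split u v rewrite A-sym v u with toℕ u <ᵇ toℕ v | A u v | S u | S v
  ... | false | _     | _     | _     = refl
  ... | true  | false | _     | _     = refl
  ... | true  | true  | false | false = refl
  ... | true  | true  | false | true  = refl
  ... | true  | true  | true  | false = refl
  ... | true  | true  | true  | true  = refl
  merge : ∀ u v → up u v + down u v ≡ 𝟙 (cut A S u v)
  merge u v with <-cmp (toℕ u) (toℕ v)
  ... | tri< u<v _ _ rewrite <⇒<ᵇ≡true u<v | ≤⇒<ᵇ≡false (<⇒≤ u<v) = +-identityʳ _
  ... | tri> _ _ v<u rewrite <⇒<ᵇ≡true v<u | ≤⇒<ᵇ≡false (<⇒≤ v<u) = refl
  ... | tri≈ _ u≡v _ with refl ← toℕ-injective u≡v rewrite ≤⇒<ᵇ≡false (≤-refl {toℕ u}) with S u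
  ...   | false = sym (cong 𝟙 (∧-zeroʳ (A u u)))
  ...   | true  = sym (cong 𝟙 (∧-zeroʳ (A u u)))

module _ (k n : ℕ) where

  -- Symmetric in `u` and `v`, so the increasing order imposed by `inF` has no effect.
  cutSet : (V k n → Bool) → EdgeSet k n
  cutSet S u v = S u xor S v

  inF-cutSet : ∀ S u v → inF k n (cutSet S) u v ≡ Adj k n u v ∧ (S u xor S v)
  inF-cutSet S u v with toℕ u <ᵇ toℕ v
  ... | true  = refl
  ... | false = cong (Adj k n u v ∧_) (xor-comm (S v) (S u))

  card-cutSet : ∀ S → card k n (cutSet S) ≡ ∂ k n S
  card-cutSet S = trans (card-sum k n (cutSet S)) (trans
    (sum-cong-≗ λ u → sum-cong-≗ λ v → cong (λ b → 𝟙 ((toℕ u <ᵇ toℕ v) ∧ b)) (inF-cutSet S u v))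
    (sym (boundary-ordered (Adj-sym k n) S)))

  stays : ∀ S {u v} → Adj k n u v ≡ true → S u ≡ S v → AdjMinus k n (cutSet S) u v
  stays S {u} {v} adj eq rewrite inF-cutSet S u v | adj | eq | xor-same (S v) = _

  AdjMinus-cutSet : ∀ S {u v} → AdjMinus k n (cutSet S) u v → S u ≡ S v
  AdjMinus-cutSet S {u} {v} e rewrite inF-cutSet S u v with Adj k n u v | S u | S v
  ... | true | false | false = refl
  ... | true | true  | true  = refl

  Reach-cutSet : ∀ S {u v} → Reach k n (cutSet S) u v → S u ≡ S v
  Reach-cutSet S ε       = refl
  Reach-cutSet S (e ◅ p) = trans (AdjMinus-cutSet S e) (Reach-cutSet S p)

  inF-sym : ∀ F u v → inF k n F u v ≡ inF k n F v u
  inF-sym F u v with <-cmp (toℕ u) (toℕ v)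
  ... | tri< u<v _ _ rewrite <⇒<ᵇ≡true u<v | ≤⇒<ᵇ≡false (<⇒≤ u<v) = cong (_∧ F u v) (Adj-sym k n u v)
  ... | tri> _ _ v<u rewrite <⇒<ᵇ≡true v<u | ≤⇒<ᵇ≡false (<⇒≤ v<u) = cong (_∧ F v u) (Adj-sym k n u v)
  ... | tri≈ _ u≡v _ with refl ← toℕ-injective u≡v = refl

  AdjMinus-sym : ∀ F {u v} → AdjMinus k n F u v → AdjMinus k n F v u
  AdjMinus-sym F {u} {v} = subst T (cong₂ (λ a b → a ∧ not b) (Adj-sym k n u v) (inF-sym F u v))

  Closed : EdgeSet k n → (V k n → Bool) → Set
  Closed F S = ∀ {u v} → S u ≡ true → AdjMinus k n F u v → S v ≡ true

  -- If an edge with exactly one end in `S` survived, one of its two orientations would lead out of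
  -- `S`; hence it lies in `F`.
  ∂≤card : ∀ F S → Closed F S → ∂ k n S ≤ card k n F
  ∂≤card F S closed = begin
    ∂ k n S
      ≡⟨ boundary-ordered (Adj-sym k n) S ⟩
    sum (λ u → sum λ v → 𝟙 (ordered (λ u v → Adj k n u v ∧ (S u xor S v)) u v))
      ≤⟨ (sum-mono λ u → sum-mono λ v → 𝟙-mono (removed u v)) ⟩
    sum (λ u → sum λ v → 𝟙 (ordered (inF k n F) u v))
      ≡⟨ card-sum k n F ⟨
    card k n F ∎
    where
    open ≤-Reasoning
    crossing : ∀ {a b} → a xor b ≡ true → (a ≡ true → b ≡ true) → (b ≡ true → a ≡ true) → true ≡ false
    crossing {false} {true}  _ _ b⇒a = sym (b⇒a refl)
    crossing {true}  {false} _ a⇒b _ = sym (a⇒b refl)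
    removed : ∀ u v → ordered (λ u v → Adj k n u v ∧ (S u xor S v)) u v ≡ true → ordered (inF k n F) u v ≡ true
    kept : ∀ {u v} → Adj k n u v ≡ true → inF k n F u v ≡ false → AdjMinus k n F u v
    kept adj ∉F = ≡⇒T (cong₂ (λ a b → a ∧ not b) adj ∉F)
    removed u v h with u<v , h′ ← ∧-true⁻ {toℕ u <ᵇ toℕ v} h with adj , across ← ∧-true⁻ {Adj k n u v} h′
      with inF k n F u v in eq
    ... | true  = cong (_∧ true) u<v
    ... | false with () ← crossing across (λ u∈S → closed u∈S (kept adj eq)) (λ v∈S → closed v∈S (AdjMinus-sym F (kept adj eq)))

-- Connected components after removing an edge set

closure : (R : Fin n → Fin n → Bool) (u : Fin n) → ∃ λ S → S u ≡ true ×
  (∀ {v w} → S v ≡ true → T (R v w) → S w ≡ true) × (∀ {v} → S v ≡ true → Star (λ v w → T (R v w)) u v)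
closure {n} R u = grow n start (size≤n (∁ start)) (dec-true (u ≟ u) refl) sound₀
  where
  Reachable : Fin n → Set
  Reachable = Star (λ v w → T (R v w)) u

  start : Fin n → Bool
  start v = does (v ≟ u)

  sound₀ : ∀ {v} → start v ≡ true → Reachable v
  sound₀ {v} _ with yes refl ← v ≟ u = ε

  size≤n : (S : Fin n → Bool) → size S ≤ n
  size≤n S = ≤-trans (m≤m+n (size S) _) (≤-reflexive (size+size-∁ S))

  insert : Fin n → (Fin n → Bool) → Fin n → Bool
  insert w S v = S v ∨ does (v ≟ w)

  size-insert : ∀ w S → S w ≡ false → size (∁ (insert w S)) < size (∁ S)
  size-insert w S w∉S = begin
    1 + size (∁ (insert w S))                            ≡⟨ +-comm 1 _ ⟩
    size (∁ (insert w S)) + 1                            ≡⟨ cong (λ b → size (∁ (insert w S)) + 𝟙 b) (dec-true (w ≟ w) refl) ⟨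
    size (∁ (insert w S)) + 𝟙 (does (w ≟ w))             ≤⟨ +-monoʳ-≤ _ (term≤sum (λ v → 𝟙 (does (v ≟ w))) w) ⟩
    size (∁ (insert w S)) + sum (λ v → 𝟙 (does (v ≟ w))) ≡⟨ ∑-distrib-+ (𝟙 ∘ ∁ (insert w S)) _ ⟨
    sum (λ v → 𝟙 (∁ (insert w S) v) + 𝟙 (does (v ≟ w)))  ≤⟨ sum-mono disjoint ⟩
    size (∁ S)                                           ∎
    where
    open ≤-Reasoning
    disjoint : ∀ v → 𝟙 (∁ (insert w S) v) + 𝟙 (does (v ≟ w)) ≤ 𝟙 (∁ S v)
    disjoint v with v ≟ w
    ... | yes refl rewrite w∉S = ≤-refl
    ... | no _ with S v
    ...   | true  = z≤n
    ...   | false = ≤-refl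

  -- As long as some `R`-step leaves `S`, its end is added; the vertices outside `S` become fewer
  -- each time, so `fuel` bounds the number of rounds.
  grow : ∀ fuel S → size (∁ S) ≤ fuel → S u ≡ true → (∀ {v} → S v ≡ true → Reachable v) →
    ∃ λ S → S u ≡ true × (∀ {v w} → S v ≡ true → T (R v w) → S w ≡ true) × (∀ {v} → S v ≡ true → Reachable v)
  grow fuel S enough u∈S sound
    with any? (λ v → any? (λ w → (S v ≟ᵇ true) ×-dec (T? (R v w) ×-dec (S w ≟ᵇ false))))
  ... | no ¬exit = S , u∈S , (λ {v} {w} v∈S vRw → ¬-not λ w∉S → ¬exit (v , w , v∈S , vRw , w∉S)) , sound
  -- Without fuel no vertex is outside `S`, yet `w` would be.
  grow zero S enough u∈S sound | yes (v , w , v∈S , vRw , w∉S)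
    with () ← ≤-trans (size-insert w S w∉S) enough
  grow (suc fuel) S enough u∈S sound | yes (v , w , v∈S , vRw , w∉S) =
    grow fuel (insert w S) (≤-pred (≤-trans (size-insert w S w∉S) enough)) (cong (_∨ does (u ≟ w)) u∈S) sound′
    where
    sound′ : ∀ {x} → insert w S x ≡ true → Reachable x
    sound′ {x} x∈ with S x in x∈S | x ≟ w
    ... | true  | _        = sound x∈S
    ... | false | yes refl = sound v∈S ◅◅ (vRw ◅ ε)

module _ (k n : ℕ) (F : EdgeSet k n) where

  Component : V k n → (V k n → Bool) → Set
  Component u S = S u ≡ true × Closed k n F S × (∀ {v} → S v ≡ true → Reach k n F u v)

  Closed-Reach : ∀ {S} → Closed k n F S → ∀ {u v} → S u ≡ true → Reach k n F u v → S v ≡ true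
  Closed-Reach closed u∈S ε       = u∈S
  Closed-Reach closed u∈S (e ◅ p) = Closed-Reach closed (closed u∈S e) p

  first-step : ∀ {u v} → u ≢ v → Reach k n F u v → ∃ λ w → AdjMinus k n F u w
  first-step u≢v ε       = contradiction refl u≢v
  first-step u≢v (e ◅ _) = _ , e

  -- The component of `u` contains a neighbour `w`. Either it has a third vertex, or it is the
  -- required component with vertices `u` and `w`.
  component-≥3 : ∀ u → (∃ λ vs → 2 ≤ length vs × Unique vs × All (Reach k n F u) vs) →
    HasTwoVertexComponent k n F ⊎ (∃ λ S → Component u S × 3 ≤ size S)
  component-≥3 u ([]         , ()       , _)
  component-≥3 u (_ ∷ []     , s≤s ()   , _)
  component-≥3 u (a ∷ b ∷ _  , _ , (a≢b ∷ _) ∷ _ , u⇝a ∷ u⇝b ∷ _) = answer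
    where
    other : ∃ λ w → AdjMinus k n F u w
    -- Since `a` and `b` differ, one of them is not `u`, and a walk to it starts with a surviving
    -- edge.
    other with u ≟ a
    ... | no u≢a   = first-step u≢a u⇝a
    ... | yes refl = first-step a≢b u⇝b
    answer : HasTwoVertexComponent k n F ⊎ (∃ λ S → Component u S × 3 ≤ size S)
    answer with w , e ← other
      with S , u∈S , closed , sound ← closure (λ u v → Adj k n u v ∧ not (inF k n F u v)) u
      with any? (λ v → (S v ≟ᵇ true) ×-dec ((¬? (u ≟ v)) ×-dec (¬? (w ≟ v))))
    ... | yes (v , v∈S , u≢v , w≢v) = inj₂ (S , (u∈S , closed , sound) , (begin
      3                                  ≡⟨ cong₂ (λ a b → a + b) (cong 𝟙 u∈S) (cong₂ (λ a b → 𝟙 a + 𝟙 b) (closed u∈S e) v∈S) ⟨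
      𝟙 (S u) + (𝟙 (S w) + 𝟙 (S v))      ≤⟨ three≤sum (𝟙 ∘ S) u≢w u≢v w≢v ⟩
      size S                             ∎))
      where
      open ≤-Reasoning
      u≢w : u ≢ w
      u≢w = Adj⇒≢ k n (proj₁ (∧-true⁻ (T⇒≡ e)))
    ... | no ¬third = inj₁ (u , w , e , within)
      where
      within : ∀ v → Reach k n F u v → v ≡ u ⊎ v ≡ w
      within v u⇝v with u ≟ v | w ≟ v
      ... | yes u≡v | _       = inj₁ (sym u≡v)
      ... | no _    | yes w≡v = inj₂ (sym w≡v)
      ... | no u≢v  | no w≢v  = contradiction (v , Closed-Reach closed u∈S u⇝v , u≢v , w≢v) ¬third

  -- The components of two separated vertices are disjoint, so the second lies in the complement of
  -- the first and both sides have at least 3 vertices.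
  ≥3-cut : ∀ {b} → (∀ S → 3 ≤ size S → 3 ≤ size (∁ S) → b ≤ ∂ k n S) → IsRestrictedCut 2 k n F →
    HasTwoVertexComponent k n F ⊎ b ≤ card k n F
  ≥3-cut bound ((u , v , ¬u⇝v) , large) with component-≥3 u (large u) | component-≥3 v (large v)
  ... | inj₁ found | _ = inj₁ found
  ... | inj₂ _ | inj₁ found = inj₁ found
  ... | inj₂ (S , (u∈S , closed , sound) , 3≤S) | inj₂ (S′ , (_ , _ , sound′) , 3≤S′) =
    inj₂ (≤-trans (bound S 3≤S (≤-trans 3≤S′ (sum-mono λ w → 𝟙-mono (disjoint w)))) (∂≤card k n F S closed))
    where
    disjoint : ∀ w → S′ w ≡ true → not (S w) ≡ true
    disjoint w w∈S′ with S w in w∈S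
    ... | false = refl
    ... | true  = contradiction (sound w∈S ◅◅ reverse (AdjMinus-sym k n F) (sound′ w∈S′)) ¬u⇝v

  -- A minimum cut is no larger than the one around `S`, which rules out the alternative of two
  -- large sides.
  cheap-cut⇒isolated-edge : ∀ {b} → (∀ S → 3 ≤ size S → 3 ≤ size (∁ S) → b < ∂ k n S) →
    ∀ S → IsRestrictedCut 2 k n (cutSet k n S) → ∂ k n S ≤ b →
    IsMinRestrictedCut 2 k n F → HasTwoVertexComponent k n F
  cheap-cut⇒isolated-edge bound S S-restricted ∂S≤b (restricted , minimal) with ≥3-cut bound restricted
  ... | inj₁ found  = found
  ... | inj₂ b<card = contradiction b<card
    (≤⇒≯ (≤-trans (minimal (cutSet k n S) S-restricted) (≤-trans (≤-reflexive (card-cutSet k n S)) ∂S≤b)))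

-- The cut around the edge {0 , 1} is 2-restricted, and the conclusion

pair-mate : ∀ m k u → pair u ≡ true → ∃ λ v → pair v ≡ true × Adj k (2 + m) u v ≡ true
pair-mate m zero zero          _ = suc zero , refl , refl
pair-mate m zero (suc zero)    _ = zero , refl , refl
pair-mate m zero (suc (suc _)) ()
pair-mate m (suc k) u u∈ with vertex-surjective k (2 + m) u
... | suc i , x , refl with () ← trans (sym u∈) (PairCut.pair-suc k (2 + m) (2≤t m k) i x)
... | zero , x , refl
  with y , y∈ , adj ← pair-mate m k x (trans (sym (PairCut.pair-zero k (2 + m) (2≤t m k) x)) u∈)
  = vertex k (2 + m) zero y , trans (PairCut.pair-zero k (2 + m) (2≤t m k) y) y∈ , trans (Adj-inside k (2 + m) zero x y) adj

module _ (m k : ℕ) where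

  open PairCut k (2 + m) (2≤t m k)

  -- A neighbour on the same side keeps every component at two or more vertices. Outside copy 0 it
  -- is found in the same copy, for a vertex of the pair it is the other one, and for the rest of
  -- copy 0 it is the end of the outer edge.
  mate : ∀ u → ∃ λ v → Adj (suc k) (2 + m) u v ≡ true × pair u ≡ pair v
  mate u with vertex-surjective k (2 + m) u
  ... | suc i , x , refl with y , adj ← neighbour k (s≤s (s≤s z≤n)) x
    = vertex k (2 + m) (suc i) y , trans (Adj-inside k (2 + m) (suc i) x y) adj , trans (pair-suc i x) (sym (pair-suc i y))
  ... | zero , x , refl with pair (vertex k (2 + m) zero x) in x∈
  ...   | true  with v , v∈ , adj ← pair-mate m (suc k) (vertex k (2 + m) zero x) x∈ = v , adj , sym v∈
  ...   | false with y , adj ← Adj-across k (2 + m) zero x = vertex k (2 + m) (suc x) y , adj , sym (pair-suc x y)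

  pair-restrictedCut : IsRestrictedCut 2 (suc k) (2 + m) (cutSet (suc k) (2 + m) pair)
  pair-restrictedCut = (vertex k (2 + m) zero origin , vertex k (2 + m) (suc origin) origin , separated) , large
    where
    separated : ¬ Reach (suc k) (2 + m) (cutSet (suc k) (2 + m) pair) (vertex k (2 + m) zero origin) (vertex k (2 + m) (suc origin) origin)
    separated p with () ← trans (sym (trans (pair-zero origin) (cong (_<ᵇ 2) toℕ-origin)))
                                (trans (Reach-cutSet (suc k) (2 + m) pair p) (pair-suc origin origin))
    large : ∀ u → ∃ λ vs → 2 ≤ length vs × Unique vs × All (Reach (suc k) (2 + m) (cutSet (suc k) (2 + m) pair) u) vs
    large u with v , adj , same ← mate u =
      u ∷ v ∷ [] , s≤s (s≤s z≤n) , ((Adj⇒≢ (suc k) (2 + m) adj ∷ []) ∷ [] ∷ []) , ε ∷ (stays (suc k) (2 + m) pair adj same ◅ ε) ∷ []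

super-λ₂ : ∀ m k → 1 ≤ k ⊎ m ≡ 0 → ∀ F →
  IsMinRestrictedCut 2 (2 + k) (2 + m) F → HasTwoVertexComponent (2 + k) (2 + m) F
super-λ₂ m k k,m F = cheap-cut⇒isolated-edge (2 + k) (2 + m) F
  -- With `δ = degree m (suc k)` the degree at level `2 + k` is `suc δ`, so the cut around the pair
  -- has at most `2 (δ + 1) - 2 = 2δ` edges.
  (2degree-2<∂ m k k,m) pair (pair-restrictedCut m (suc k)) (cancel (degree m (suc k)) (∂-pair m (2 + k)))
  where
  shift : ∀ a → suc a + suc a ≡ a + a + 2
  shift = solve-∀
  cancel : ∀ {c} δ → c + 2 ≤ suc δ + suc δ → c ≤ δ + δ
  cancel {c} δ c+2≤ = +-cancelʳ-≤ 2 _ _ (subst (c + 2 ≤_) (shift δ) c+2≤)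

theorem8 : (k n : ℕ) → (k ≥ 3 × n ≥ 2) ⊎ (k ≡ 2 × n ≡ 2) →
    (F : EdgeSet k n) → IsMinRestrictedCut 2 k n F → HasTwoVertexComponent k n F
theorem8 (suc (suc k)) (suc (suc m)) (inj₁ (s≤s (s≤s 1≤k) , _)) = super-λ₂ m k (inj₁ 1≤k)
theorem8 (suc zero)    _             (inj₁ (s≤s () , _))
theorem8 (suc (suc _)) (suc zero)    (inj₁ (_ , s≤s ()))
theorem8 _             _             (inj₂ (refl , refl))       = super-λ₂ 0 0 (inj₂ refl)
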